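{- For every integer $k\ge 4$, $\tilde{r}(P_3,P_3,C_{4k-2}) \le 6k-2$.
   Context: $P_m$ denotes the path and $C_m$ the cycle on $m$ vertices. The three-color online Ramsey game for graphs $G_1,G_2,G_3$ is played by Builder and Painter on an infinite vertex set with initially no edges. In each round Builder draws an edge between two currently nonadjacent vertices, and Painter immediately colors it red, blue or green. Builder wins once the colored graph contains a red copy of $G_1$, a blue copy of $G_2$, or a green copy of $G_3$. The online Ramsey number $\tilde{r}(G_1,G_2,G_3)$ is the minimum number of rounds within which Builder can guarantee a win against every strategy of Painter. -}

module Defs where

open import Data.Nat using (ℕ; zero; suc; _∸_; _*_; _+_)
open import Data.Fin using (Fin; zero; suc; inject₁; fromℕ)
open import Data.Product using (Σ; _×_; _,_)
open import Data.Sum using (_⊎_)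
open import Data.Empty using (⊥)
open import Data.Unit using (⊤)
open import Data.List using (List; []; _∷_)
open import Data.List.Membership.Propositional using (_∈_)
open import Relation.Binary.PropositionalEquality using (_≡_; _≢_)
open import Relation.Nullary using (¬_)
open import Function.Definitions using (Injective)

data Color : Set where
  red blue green : Color

Vertex : Set
Vertex = ℕ

ColoredEdge : Set
ColoredEdge = Vertex × Vertex × Color

Board : Set
Board = List ColoredEdge

ColEdge : Board → Color → Vertex → Vertex → Set
ColEdge b c u v = ((u , v , c) ∈ b) ⊎ ((v , u , c) ∈ b)

Adjacent : Board → Vertex → Vertex → Set
Adjacent b u v = Σ Color λ c → ColEdge b c u v

-- b contains a copy of P_m (m vertices) all of whose edges have colour c.
-- P_0 is taken to be trivially present (never used below).
HasPath : Color → ℕ → Board → Set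
HasPath c zero b = ⊤
HasPath c (suc n) b =
  Σ (Fin (suc n) → Vertex) λ f →
    Injective _≡_ _≡_ f ×
    ((i : Fin n) → ColEdge b c (f (inject₁ i)) (f (suc i)))

-- b contains a copy of the cycle C_m (m vertices v_0 … v_{m-1}, edges
-- v_i v_{i+1} and v_{m-1} v_0) all of whose edges have colour c.
-- (Only used for m ≥ 3; C_0 is never present.)
HasCycle : Color → ℕ → Board → Set
HasCycle c zero b = ⊥
HasCycle c (suc n) b =
  Σ (Fin (suc n) → Vertex) λ f →
    Injective _≡_ _≡_ f ×
    ((i : Fin n) → ColEdge b c (f (inject₁ i)) (f (suc i))) ×
    ColEdge b c (f (fromℕ n)) (f zero)

Won : ℕ → Board → Set
Won m b = HasPath red 3 b ⊎ HasPath blue 3 b ⊎ HasCycle green m b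

-- BuilderWinsIn m n b : from position b, Builder can force a win in the
-- online Ramsey game for (P_3, P_3, C_m) within at most n further rounds,
-- against every Painter strategy.  In each round Builder chooses two
-- distinct nonadjacent vertices and Painter picks any colour.
BuilderWinsIn : ℕ → ℕ → Board → Set
BuilderWinsIn m zero b = Won m b
BuilderWinsIn m (suc n) b =
  Won m b ⊎
  Σ Vertex λ u → Σ Vertex λ v →
    (u ≢ v) × ¬ Adjacent b u v ×
    ((c : Color) → BuilderWinsIn m n ((u , v , c) ∷ b))

OnlineRamseyLE : ℕ → ℕ → Set
OnlineRamseyLE m n = BuilderWinsIn m n []

{-# OPTIONS --safe #-}
module Submission where

-- Unless Painter loses at once, every vertex gets at most one red and at most one blue edge.
-- So an edge is forced to be green when one of its ends already has both colours, or when one end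
-- has a red edge and the other a blue one.  Builder keeps a few disjoint green paths and remembers
-- of each path end (and of some single vertices) which colours it has.  He needs 4k − 2 green edges
-- on the cycle and may waste 2k edges.  A green answer at a vertex that could have refused is a gain,
-- a red or blue answer between two single vertices costs nothing in the long run: it creates
-- vertices that later force green edges.  It remains to keep "green edges still missing" at most about
-- twice "edges that may be wasted" until the paths close up to a cycle of exactly the right length.

open import Defs
open import Data.Bool using (Bool; true; false; T; not; _∧_; _∨_; if_then_else_)
open import Data.Bool.ListAction using (all)
open import Data.Bool.Properties using (T-∧; T-∨)
open import Data.Empty using (⊥-elim)
open import Data.Fin using (Fin; zero; suc; inject₁; fromℕ)
open import Data.List using (List; []; _∷_; _++_; [_]; length; lookup; map; reverse)
open import Data.List.Extrema.Nat using (max; xs≤max; ⊥≤max)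
open import Data.List.Membership.Propositional using (_∈_)
open import Data.List.Membership.Propositional.Properties using (∈-++⁺ˡ; ∈-++⁺ʳ; ∈-lookup)
open import Data.List.Properties using (length-++; unfold-reverse)
open import Data.List.Relation.Binary.Permutation.Propositional using (_↭_; ↭-refl; ↭-sym; ↭-trans; ↭⇒↭ₛ)
open import Data.List.Relation.Binary.Permutation.Propositional.Properties using (++⁺ˡ; ++⁺ʳ; ++⁺; ++-assoc; shifts; ↭-length; ↭-reverse)
import Data.List.Relation.Binary.Permutation.Setoid.Properties as PermutationSetoid
open import Data.List.Relation.Unary.All as All using (All; []; _∷_)
import Data.List.Relation.Unary.All.Properties as Allₚ
open import Data.List.Relation.Unary.AllPairs using ([]; _∷_)
open import Data.List.Relation.Unary.Any using (here; there)
open import Data.List.Relation.Unary.Unique.Propositional using (Unique)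
open import Data.Nat using (ℕ; zero; suc; _+_; _*_; _∸_; _≤_; _⊔_; _≡ᵇ_; _≤?_; z≤n; s≤s; s≤s⁻¹)
open import Data.Nat.Properties
open import Data.Nat.Tactic.RingSolver using (solve-∀)
open import Data.Product using (∃; ∃₂; _×_; _,_; proj₁; proj₂)
open import Data.Product.Properties using (≡-dec)
open import Data.Sum as Sum using (_⊎_; inj₁; inj₂; swap)
open import Data.Unit using (⊤; tt)
open import Function using (_∘_; id; Equivalence)
open import Relation.Binary.Definitions using (DecidableEquality)
open import Relation.Binary.PropositionalEquality using (_≡_; _≢_; refl; sym; trans; cong; cong₂; subst; subst₂; setoid; module ≡-Reasoning)
open import Relation.Nullary using (¬_; Dec; yes; no)
open import Relation.Nullary.Decidable using (_⊎-dec_)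

-- Lists without repetition

Unique-resp-↭ : {xs ys : List ℕ} → xs ↭ ys → Unique xs → Unique ys
Unique-resp-↭ p = PermutationSetoid.Unique-resp-↭ (setoid ℕ) (↭⇒↭ₛ p)

Unique-++ˡ : (xs : List ℕ) {ys : List ℕ} → Unique (xs ++ ys) → Unique xs
Unique-++ˡ [] _ = []
Unique-++ˡ (x ∷ xs) (x∉ ∷ u) = Allₚ.++⁻ˡ xs x∉ ∷ Unique-++ˡ xs u

Unique-++ʳ : (xs : List ℕ) {ys : List ℕ} → Unique (xs ++ ys) → Unique ys
Unique-++ʳ [] u = u
Unique-++ʳ (x ∷ xs) (_ ∷ u) = Unique-++ʳ xs u

lookup-injective : {xs : List ℕ} → Unique xs → ∀ {i j} → lookup xs i ≡ lookup xs j → i ≡ j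
lookup-injective (_ ∷ _) {zero} {zero} _ = refl
lookup-injective (x∉ ∷ _) {zero} {suc j} eq = ⊥-elim (All.lookup x∉ (∈-lookup j) eq)
lookup-injective (x∉ ∷ _) {suc i} {zero} eq = ⊥-elim (All.lookup x∉ (∈-lookup i) (sym eq))
lookup-injective (_ ∷ u) {suc i} {suc j} eq = cong suc (lookup-injective u eq)

-- Boards

data Path (β : Board) : Vertex → Vertex → List Vertex → Set where
  stop : ∀ {a} → Path β a a [ a ]
  _◂_  : ∀ {a c z l} → ColEdge β green a c → Path β c z l → Path β a z (a ∷ l)

extend : ∀ {β e c u v} → ColEdge β c u v → ColEdge (e ∷ β) c u v
extend = Sum.map there there

extendPath : ∀ {β e a z l} → Path β a z l → Path (e ∷ β) a z l
extendPath stop = stop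
extendPath (g ◂ p) = extend g ◂ extendPath p

bridge : ∀ {β a c d z l m} → Path β a c l → ColEdge β green c d → Path β d z m → Path β a z (l ++ m)
bridge stop g q = g ◂ q
bridge (h ◂ p) g q = h ◂ bridge p g q

reversePath : ∀ {β a z l} → Path β a z l → Path β z a (reverse l)
reversePath stop = stop
reversePath {l = a ∷ l} (g ◂ p) =
  subst (Path _ _ _) (sym (unfold-reverse a l)) (bridge (reversePath p) (swap g) stop)

last∈ : ∀ {β a z l} → Path β a z l → z ∈ l
last∈ stop = here refl
last∈ (_ ◂ p) = there (last∈ p)

-- This is what makes a piece named `(n , n)` contribute exactly one vertex, hence no green edge.
closed-length : ∀ {β a l} → Path β a a l → Unique l → length l ≡ 1
closed-length stop _ = refl
closed-length (_ ◂ p) (a∉ ∷ _) = ⊥-elim (All.lookup a∉ (last∈ p) refl)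

cycle : ∀ {β a z l} → Path β a z l → Unique l → ColEdge β green z a → HasCycle green (length l) β
cycle {β} {l = l} p u g with p
... | stop = lookup l , lookup-injective u , (λ ()) , g
... | h ◂ q = lookup l , lookup-injective u , edges (h ◂ q) , subst (λ v → ColEdge β green v _) (sym (last (h ◂ q))) g
  where
  edges : ∀ {a z v l} → Path β a z (v ∷ l) → (i : Fin (length l)) →
          ColEdge β green (lookup (v ∷ l) (inject₁ i)) (lookup (v ∷ l) (suc i))
  edges (h ◂ stop) zero = h
  edges (h ◂ (_ ◂ _)) zero = h
  edges (h ◂ stop) (suc ())
  edges (h ◂ q@(_ ◂ _)) (suc i) = edges q i
  last : ∀ {a z v l} → Path β a z (v ∷ l) → lookup (v ∷ l) (fromℕ (length l)) ≡ z
  last stop = refl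
  last (_ ◂ q@stop) = last q
  last (_ ◂ q@(_ ◂ _)) = last q

_≟ᶜ_ : DecidableEquality Color
red ≟ᶜ red = yes refl
red ≟ᶜ blue = no λ ()
red ≟ᶜ green = no λ ()
blue ≟ᶜ red = no λ ()
blue ≟ᶜ blue = yes refl
blue ≟ᶜ green = no λ ()
green ≟ᶜ red = no λ ()
green ≟ᶜ blue = no λ ()
green ≟ᶜ green = yes refl

open import Data.List.Membership.DecPropositional (≡-dec _≟_ (≡-dec _≟_ _≟ᶜ_)) using (_∈?_)

colEdge? : ∀ β c u v → Dec (ColEdge β c u v)
colEdge? β c u v = ((u , v , c) ∈? β) ⊎-dec ((v , u , c) ∈? β)

adjacent? : ∀ β u v → Dec (Adjacent β u v)
adjacent? β u v with colEdge? β red u v | colEdge? β blue u v | colEdge? β green u v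
... | yes e | _ | _ = yes (red , e)
... | no _ | yes e | _ = yes (blue , e)
... | no _ | no _ | yes e = yes (green , e)
... | no ¬r | no ¬b | no ¬g = no λ { (red , e) → ¬r e ; (blue , e) → ¬b e ; (green , e) → ¬g e }

bound : Board → ℕ
bound [] = 0
bound ((u , v , _) ∷ β) = (u ⊔ v) ⊔ bound β

bounded : ∀ {β u v c} → (u , v , c) ∈ β → u ≤ bound β × v ≤ bound β
bounded {(u , v , _) ∷ β} (here refl) =
  ≤-trans (m≤m⊔n u v) (m≤m⊔n _ _) , ≤-trans (m≤n⊔m u v) (m≤m⊔n _ _)
bounded {(u , v , _) ∷ β} (there e) with bounded e
... | p , q = ≤-trans p (m≤n⊔m (u ⊔ v) _) , ≤-trans q (m≤n⊔m (u ⊔ v) _)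

colEdge-bounded : ∀ {β u v c} → ColEdge β c u v → u ≤ bound β
colEdge-bounded (inj₁ e) = proj₁ (bounded e)
colEdge-bounded (inj₂ e) = proj₂ (bounded e)

triple : ∀ {β c u v w} → u ≢ v → u ≢ w → v ≢ w → ColEdge β c u v → ColEdge β c v w → HasPath c 3 β
triple {u = u} {v} {w} u≢v u≢w v≢w e e′ = lookup (u ∷ v ∷ w ∷ []) ,
  lookup-injective ((u≢v ∷ u≢w ∷ []) ∷ (v≢w ∷ []) ∷ [] ∷ []) ,
  λ { zero → e ; (suc zero) → e′ }

won⇒wins : ∀ {m b} n → Won m b → BuilderWinsIn m n b
won⇒wins zero w = w
won⇒wins (suc n) w = inj₁ w

wins-suc : ∀ {m b} n → BuilderWinsIn m n b → BuilderWinsIn m (suc n) b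
wins-suc zero w = inj₁ w
wins-suc (suc n) (inj₁ w) = inj₁ w
wins-suc (suc n) (inj₂ (u , v , u≢v , ¬a , f)) = inj₂ (u , v , u≢v , ¬a , λ c → wins-suc n (f c))

-- Positions

-- The two hues stand for red and blue in an order that Realizes leaves open, so that positions
-- need only be treated up to exchanging these colours.
data Hue : Set where
  warm cool : Hue

data Kind : Set where
  bare full : Kind
  half : Hue → Kind

has : Hue → Kind → Bool
has _ bare = false
has _ full = true
has warm (half warm) = true
has warm (half cool) = false
has cool (half warm) = false
has cool (half cool) = true

add : Hue → Kind → Kind
add h bare = half h
add _ full = full
add warm (half warm) = half warm
add warm (half cool) = full
add cool (half warm) = full
add cool (half cool) = half cool

has-add : ∀ h h′ k → T (has h′ (add h k)) → h′ ≡ h ⊎ T (has h′ k)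
has-add warm warm _ _ = inj₁ refl
has-add cool cool _ _ = inj₁ refl
has-add warm cool full _ = inj₂ tt
has-add warm cool (half cool) _ = inj₂ tt
has-add cool warm full _ = inj₂ tt
has-add cool warm (half warm) _ = inj₂ tt

-- Vertices are referred to by names.  A piece is a green path, given by the names of its two ends;
-- (n , n) is the path consisting of the single vertex n.
Piece : Set
Piece = ℕ × ℕ

-- Names without an entry in kinds are bare; links contains all pairs of path ends that may be
-- joined by a red or blue edge.
record Position : Set where
  constructor ⟨_∣_∣_⟩
  field
    pieces : List Piece
    kinds  : List (ℕ × Kind)
    links  : List (ℕ × ℕ)
open Position public

at : ℕ → Piece → Bool
at u (p , q) = (u ≡ᵇ p) ∨ (u ≡ᵇ q)

far : ℕ → Piece → ℕ
far u (p , q) = if u ≡ᵇ p then q else p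

live : ℕ → List Piece → Bool
live u [] = false
live u (p ∷ ps) = at u p ∨ live u ps

other : ℕ → List Piece → ℕ
other u [] = u
other u (p ∷ ps) = if at u p then far u p else other u ps

rest : ℕ → List Piece → List Piece
rest u [] = []
rest u (p ∷ ps) = if at u p then ps else p ∷ rest u ps

kindIn : List (ℕ × Kind) → ℕ → Kind
kindIn [] n = bare
kindIn ((m , k) ∷ ks) n = if n ≡ᵇ m then k else kindIn ks n

kind : Position → ℕ → Kind
kind s = kindIn (kinds s)

linkedIn : List (ℕ × ℕ) → ℕ → ℕ → Bool
linkedIn [] m n = false
linkedIn ((p , q) ∷ ps) m n =
  ((m ≡ᵇ p) ∧ (n ≡ᵇ q)) ∨ ((m ≡ᵇ q) ∧ (n ≡ᵇ p)) ∨ linkedIn ps m n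

linked : Position → ℕ → ℕ → Bool
linked s = linkedIn (links s)

sprout : ℕ → Position → Position
sprout n s = ⟨ (n , n) ∷ pieces s ∣ (n , bare) ∷ kinds s ∣ links s ⟩

join : ℕ → ℕ → Position → Position
join u v ⟨ ps ∣ ks ∣ ls ⟩ =
  ⟨ (other u ps , other v (rest u ps)) ∷ rest v (rest u ps) ∣ ks ∣ ls ⟩

mark : Hue → ℕ → ℕ → Position → Position
mark h u v s = ⟨ pieces s ∣ (u , add h (kind s u)) ∷ (v , add h (kind s v)) ∷ kinds s ∣ (u , v) ∷ links s ⟩

-- With a blocked hue Painter would complete a monochromatic path on three vertices. That the older
-- edge is not the edge `u v` itself is ensured by `links`.
blocked : Hue → ℕ → ℕ → Position → Bool
blocked h u v s = has h (kind s u) ∨ has h (kind s v)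

-- Realizations of a position on a board

colour : Bool → Hue → Color
colour false warm = red
colour false cool = blue
colour true warm = blue
colour true cool = red

colour≢green : ∀ σ h → colour σ h ≢ green
colour≢green false warm ()
colour≢green false cool ()
colour≢green true warm ()
colour≢green true cool ()

-- The vertex lists are concatenated so that one `Unique` says both that each path is simple and
-- that the paths are disjoint.
data Segments (β : Board) (α : ℕ → Vertex) : List Piece → List Vertex → Set where
  []  : Segments β α [] []
  _∷_ : ∀ {u v l ps m} → Path β (α u) (α v) l → Segments β α ps m → Segments β α ((u , v) ∷ ps) (l ++ m)

-- ρ is the number of edges that the green paths lack for a cycle of length ℓ.
record Realizes (ℓ : ℕ) (σ : Bool) (α : ℕ → Vertex) (β : Board) (s : Position) (ρ : ℕ) : Set where
  field
    vertices : List Vertex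
    segments : Segments β α (pieces s) vertices
    unique   : Unique vertices
    size     : length vertices + ρ ≡ ℓ + length (pieces s)
    distinct : ∀ {m n} → T (live m (pieces s)) → T (live n (pieces s)) → m ≢ n → α m ≢ α n
    touched  : ∀ {n} h → T (live n (pieces s)) → T (has h (kind s n)) →
               ∃ λ w → w ≢ α n × ColEdge β (colour σ h) (α n) w
    unlinked : ∀ {m n} h → T (live m (pieces s)) → T (live n (pieces s)) → m ≢ n →
               ColEdge β (colour σ h) (α m) (α n) → T (linked s m n)

open Realizes public

≡ᵇ-refl : ∀ n → T (n ≡ᵇ n)
≡ᵇ-refl n = ≡⇒≡ᵇ n n refl

∨-elim : ∀ {x y} → T (x ∨ y) → T x ⊎ T y
∨-elim = Equivalence.to T-∨

∧-elim : ∀ {x y} → T (x ∧ y) → T x × T y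
∧-elim = Equivalence.to T-∧

∨-introˡ : ∀ {x y} → T x → T (x ∨ y)
∨-introˡ = Equivalence.from T-∨ ∘ inj₁

∨-introʳ : ∀ {x y} → T y → T (x ∨ y)
∨-introʳ {x} = Equivalence.from (T-∨ {x}) ∘ inj₂

not-elim : ∀ {x} → T (not x) → ¬ T x
not-elim {false} _ ()

≢-sound : ∀ {m n} → T (not (m ≡ᵇ n)) → m ≢ n
≢-sound {m} {n} p eq = not-elim p (≡⇒≡ᵇ m n eq)

at-far : ∀ u p → T (at u p) → T (at (far u p) p)
at-far u (p , q) h with u ≡ᵇ p
... | true = ∨-introʳ {q ≡ᵇ p} (≡ᵇ-refl q)
... | false = ∨-introˡ (≡ᵇ-refl p)

live-other : ∀ u ps → T (live u ps) → T (live (other u ps) ps)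
live-other u (p ∷ ps) h with at u p in eq
... | true = ∨-introˡ (at-far u p (subst T (sym eq) tt))
... | false = ∨-introʳ {at (other u ps) p} (live-other u ps h)

live-rest : ∀ {n} u ps → T (live n (rest u ps)) → T (live n ps)
live-rest {n} u (p ∷ ps) h with at u p
... | true = ∨-introʳ {at n p} h
... | false with ∨-elim {at n p} h
...   | inj₁ h′ = ∨-introˡ h′
...   | inj₂ h′ = ∨-introʳ {at n p} (live-rest u ps h′)

length-rest : ∀ u ps → T (live u ps) → length ps ≡ suc (length (rest u ps))
length-rest u (p ∷ ps) h with at u p
... | true = refl
... | false = cong suc (length-rest u ps h)

module _ {β : Board} {α : ℕ → Vertex} where

  orient : ∀ {p q l} u → T (at u (p , q)) → Path β (α p) (α q) l →
           ∃ λ l′ → Path β (α u) (α (far u (p , q))) l′ × l ↭ l′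
  orient {p} {q} {l} u h π with u ≡ᵇ p in eq
  ... | true rewrite ≡ᵇ⇒≡ u p (subst T (sym eq) tt) = l , π , ↭-refl
  ... | false rewrite ≡ᵇ⇒≡ u q h = reverse l , reversePath π , ↭-sym (↭-reverse l)

  -- Vertex lists are tracked only up to permutation, which preserves `Unique` and the length.
  pull : ∀ {m} u ps → T (live u ps) → Segments β α ps m →
         ∃₂ λ l m′ → Path β (α u) (α (other u ps)) l × Segments β α (rest u ps) m′ × m ↭ l ++ m′
  pull u (p ∷ ps) h (_∷_ {l = l} {m = m} π S) with at u p in eq
  ... | true with orient u (subst T (sym eq) tt) π
  ...   | l′ , π′ , l↭l′ = l′ , m , π′ , S , ++⁺ʳ m l↭l′
  pull u (p ∷ ps) h (_∷_ {l = l} {m = m} π S) | false with pull u ps h S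
  ...   | l′ , m′ , π′ , S′ , m↭ = l′ , l ++ m′ , π′ , π ∷ S′ , ↭-trans (++⁺ˡ l m↭) (shifts l l′)

extendSegments : ∀ {β α e ps m} → Segments β α ps m → Segments (e ∷ β) α ps m
extendSegments [] = []
extendSegments (p ∷ S) = extendPath p ∷ extendSegments S

relabel : ∀ {β α α′ m} ps → (∀ n → T (live n ps) → α n ≡ α′ n) → Segments β α ps m → Segments β α′ ps m
relabel [] _ [] = []
relabel {β} ((u , v) ∷ ps) eq (π ∷ S) =
  subst₂ (λ a z → Path β a z _) (eq u (∨-introˡ (∨-introˡ (≡ᵇ-refl u)))) (eq v (∨-introˡ (∨-introʳ {v ≡ᵇ u} (≡ᵇ-refl v)))) π
  ∷ relabel ps (λ n h → eq n (∨-introʳ {at n (u , v)} h)) S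

kind-here : ∀ n k ks → kindIn ((n , k) ∷ ks) n ≡ k
kind-here n k ks with n ≡ᵇ n | ≡ᵇ-refl n
... | true | _ = refl

kind-there : ∀ {m n} k ks → n ≢ m → kindIn ((m , k) ∷ ks) n ≡ kindIn ks n
kind-there {m} {n} k ks n≢m with n ≡ᵇ m in eq
... | true = ⊥-elim (n≢m (≡ᵇ⇒≡ n m (subst T (sym eq) tt)))
... | false = refl

at-elim : ∀ {n p q} → T (at n (p , q)) → n ≡ p ⊎ n ≡ q
at-elim {n} {p} {q} h with ∨-elim {n ≡ᵇ p} h
... | inj₁ h′ = inj₁ (≡ᵇ⇒≡ n p h′)
... | inj₂ h′ = inj₂ (≡ᵇ⇒≡ n q h′)

linked-here : ∀ m n {ls} → T (linkedIn ((m , n) ∷ ls) m n)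
linked-here m n = ∨-introˡ (Equivalence.from T-∧ (≡ᵇ-refl m , ≡ᵇ-refl n))

linked-flip : ∀ m n {ls} → T (linkedIn ((m , n) ∷ ls) n m)
linked-flip m n = ∨-introʳ {(n ≡ᵇ m) ∧ (m ≡ᵇ n)} (∨-introˡ (Equivalence.from T-∧ (≡ᵇ-refl n , ≡ᵇ-refl m)))

linked-there : ∀ {p q} m n {ls} → T (linkedIn ls m n) → T (linkedIn ((p , q) ∷ ls) m n)
linked-there {p} {q} m n h = ∨-introʳ {(m ≡ᵇ p) ∧ (n ≡ᵇ q)} (∨-introʳ {(m ≡ᵇ q) ∧ (n ≡ᵇ p)} h)

hueWon : ∀ {m β} σ h → HasPath (colour σ h) 3 β → Won m β
hueWon false warm = inj₁
hueWon false cool = inj₂ ∘ inj₁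
hueWon true warm = inj₂ ∘ inj₁
hueWon true cool = inj₁

hueOf : ∀ σ c → c ≡ green ⊎ ∃ λ h → c ≡ colour σ h
hueOf _ green = inj₁ refl
hueOf false red = inj₂ (warm , refl)
hueOf false blue = inj₂ (cool , refl)
hueOf true red = inj₂ (cool , refl)
hueOf true blue = inj₂ (warm , refl)

module _ {ℓ : ℕ} {σ : Bool} {α : ℕ → Vertex} where

  extendGreen : ∀ {β s ρ a c} → Realizes ℓ σ α β s ρ → Realizes ℓ σ α ((a , c , green) ∷ β) s ρ
  extendGreen R = record
    { vertices = vertices R ; segments = extendSegments (segments R) ; unique = unique R ; size = size R
    ; distinct = distinct R
    ; touched = λ h n k → let w , w≢ , e = touched R h n k in w , w≢ , extend e
    ; unlinked = λ { h m n m≢n (inj₁ (here eq)) → ⊥-elim (colour≢green σ h (cong (proj₂ ∘ proj₂) eq))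
                   ; h m n m≢n (inj₂ (here eq)) → ⊥-elim (colour≢green σ h (cong (proj₂ ∘ proj₂) eq))
                   ; h m n m≢n (inj₁ (there e)) → unlinked R h m n m≢n (inj₁ e)
                   ; h m n m≢n (inj₂ (there e)) → unlinked R h m n m≢n (inj₂ e) } }

  name-injective : ∀ {β s ρ m n} → Realizes ℓ σ α β s ρ → T (live m (pieces s)) → T (live n (pieces s)) → α m ≡ α n → m ≡ n
  name-injective {m = m} {n} R hm hn eq with m ≟ n
  ... | yes m≡n = m≡n
  ... | no m≢n = ⊥-elim (distinct R hm hn m≢n eq)

  extendMark : ∀ {β s ρ u v} h → Realizes ℓ σ α β s ρ → T (live u (pieces s)) → T (live v (pieces s)) → u ≢ v →
               Realizes ℓ σ α ((α u , α v , colour σ h) ∷ β) (mark h u v s) ρ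
  extendMark {β} {s} {ρ} {u} {v} h R hu hv u≢v = record
    { vertices = vertices R ; segments = extendSegments (segments R) ; unique = unique R ; size = size R
    ; distinct = distinct R ; touched = touched′ ; unlinked = unlinked′ }
    where
    β′ = (α u , α v , colour σ h) ∷ β
    ks = (v , add h (kind s v)) ∷ kinds s
    old : ∀ {n} h′ → T (live n (pieces s)) → T (has h′ (kind s n)) → ∃ λ w → w ≢ α n × ColEdge β′ (colour σ h′) (α n) w
    old h′ hn k = let w , w≢ , e = touched R h′ hn k in w , w≢ , extend e
    touched′ : ∀ {n} h′ → T (live n (pieces s)) → T (has h′ (kind (mark h u v s) n)) →
               ∃ λ w → w ≢ α n × ColEdge β′ (colour σ h′) (α n) w
    touched′ {n} h′ hn k with n ≟ u
    ... | yes refl with has-add h h′ (kind s u) (subst (T ∘ has h′) (kind-here n _ ks) k)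
    ...   | inj₁ refl = α v , distinct R hu hv u≢v ∘ sym , inj₁ (here refl)
    ...   | inj₂ k′ = old h′ hn k′
    touched′ {n} h′ hn k | no n≢u with n ≟ v
    ... | yes refl with has-add h h′ (kind s v) (subst (T ∘ has h′) (trans (kind-there _ ks n≢u) (kind-here n _ (kinds s))) k)
    ...   | inj₁ refl = α u , distinct R hu hv u≢v , inj₂ (here refl)
    ...   | inj₂ k′ = old h′ hn k′
    touched′ {n} h′ hn k | no n≢u | no n≢v =
      old h′ hn (subst (T ∘ has h′) (trans (kind-there _ ks n≢u) (kind-there _ (kinds s) n≢v)) k)
    unlinked′ : ∀ {m n} h′ → T (live m (pieces s)) → T (live n (pieces s)) → m ≢ n →
                ColEdge β′ (colour σ h′) (α m) (α n) → T (linked (mark h u v s) m n)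
    unlinked′ h′ hm hn m≢n (inj₁ (here eq))
      with refl ← name-injective R hm hu (cong proj₁ eq) | refl ← name-injective R hn hv (cong (proj₁ ∘ proj₂) eq)
      = linked-here u v {links s}
    unlinked′ h′ hm hn m≢n (inj₂ (here eq))
      with refl ← name-injective R hn hu (cong proj₁ eq) | refl ← name-injective R hm hv (cong (proj₁ ∘ proj₂) eq)
      = linked-flip u v {links s}
    unlinked′ {m} {n} h′ hm hn m≢n (inj₁ (there e)) = linked-there m n {links s} (unlinked R h′ hm hn m≢n (inj₁ e))
    unlinked′ {m} {n} h′ hm hn m≢n (inj₂ (there e)) = linked-there m n {links s} (unlinked R h′ hm hn m≢n (inj₂ e))

  joined : ∀ {β s ρ} u v → Realizes ℓ σ α β s (suc ρ) → T (live u (pieces s)) → T (live v (rest u (pieces s))) →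
           ColEdge β green (α u) (α v) → Realizes ℓ σ α β (join u v s) ρ
  joined {β} {s} {ρ} u v R hu hv g
    with l₁ , m₁ , π₁ , S₁ , p₁ ← pull u (pieces s) hu (segments R)
    with l₂ , m₂ , π₂ , S₂ , p₂ ← pull v (rest u (pieces s)) hv S₁ = record
    { vertices = (reverse l₁ ++ l₂) ++ m₂
    ; segments = bridge (reversePath π₁) g π₂ ∷ S₂
    ; unique = Unique-resp-↭ perm (unique R)
    ; size = suc-injective (begin
        suc (length ((reverse l₁ ++ l₂) ++ m₂) + ρ)  ≡⟨ cong (λ n → suc (n + ρ)) (sym (↭-length perm)) ⟩
        suc (length (vertices R) + ρ)                 ≡⟨ sym (+-suc _ ρ) ⟩
        length (vertices R) + suc ρ                   ≡⟨ size R ⟩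
        ℓ + length (pieces s)                         ≡⟨ cong (ℓ +_) (length-rest u (pieces s) hu) ⟩
        ℓ + suc (length (rest u (pieces s)))          ≡⟨ cong (λ n → ℓ + suc n) (length-rest v (rest u (pieces s)) hv) ⟩
        ℓ + suc (suc (length (rest v (rest u (pieces s))))) ≡⟨ +-suc ℓ _ ⟩
        suc (ℓ + length (pieces (join u v s)))        ∎)
    ; distinct = λ hm hn → distinct R (older hm) (older hn)
    ; touched = λ h hn → touched R h (older hn)
    ; unlinked = λ h hm hn → unlinked R h (older hm) (older hn) }
    where
    open ≡-Reasoning
    perm : vertices R ↭ (reverse l₁ ++ l₂) ++ m₂
    perm = ↭-trans p₁ (↭-trans (++⁺ (↭-sym (↭-reverse l₁)) p₂) (↭-sym (++-assoc (reverse l₁) l₂ m₂)))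
    older : ∀ {n} → T (live n (pieces (join u v s))) → T (live n (pieces s))
    older {n} h with ∨-elim {at n (other u (pieces s) , other v (rest u (pieces s)))} h
    ... | inj₂ h′ = live-rest u (pieces s) (live-rest v (rest u (pieces s)) h′)
    ... | inj₁ h′ with at-elim {n} h′
    ...   | inj₁ refl = live-other u (pieces s) hu
    ...   | inj₂ refl = live-rest u (pieces s) (live-other v (rest u (pieces s)) hv)

  -- If the two vertices are adjacent already, the edge is green and Builder skips the round.
  draw : ∀ {β s ρ N} u v → Realizes ℓ σ α β s ρ → T (live u (pieces s)) → T (live v (pieces s)) → u ≢ v →
         ¬ T (linked s u v) →
         (∀ h → ¬ T (blocked h u v s) → Realizes ℓ σ α ((α u , α v , colour σ h) ∷ β) (mark h u v s) ρ →
            BuilderWinsIn ℓ N ((α u , α v , colour σ h) ∷ β)) →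
         (∀ {β′} → (∀ {c a z} → ColEdge β c a z → ColEdge β′ c a z) → Realizes ℓ σ α β′ s ρ →
            ColEdge β′ green (α u) (α v) → BuilderWinsIn ℓ N β′) →
         BuilderWinsIn ℓ (suc N) β
  draw {β} {s} {ρ} {N} u v R hu hv u≢v ¬link onMark onGreen with adjacent? β (α u) (α v)
  ... | yes (c , e) = wins-suc N (old c e)
    where
    old : ∀ c → ColEdge β c (α u) (α v) → BuilderWinsIn ℓ N β
    old c e with hueOf σ c
    ... | inj₁ refl = onGreen id R e
    ... | inj₂ (h , refl) = ⊥-elim (¬link (unlinked R h hu hv u≢v e))
  ... | no ¬adj = inj₂ (α u , α v , distinct R hu hv u≢v , ¬adj , new)
    where
    hue : ∀ h → BuilderWinsIn ℓ N ((α u , α v , colour σ h) ∷ β)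
    hue h with has h (kind s u) in equ | has h (kind s v) in eqv
    -- The old neighbour `w` is not the other end, as the pair is not linked; so both edges form a
    -- path on three vertices.
    ... | true | _ = let w , w≢ , e = touched R h hu (subst T (sym equ) tt) in
          won⇒wins N (hueWon σ h (triple w≢ (λ eq → ¬link (unlinked R h hu hv u≢v (subst (ColEdge β (colour σ h) (α u)) eq e)))
            (distinct R hu hv u≢v) (swap (extend e)) (inj₁ (here refl))))
    ... | false | true = let w , w≢ , e = touched R h hv (subst T (sym eqv) tt) in
          won⇒wins N (hueWon σ h (triple (distinct R hu hv u≢v)
            (λ eq → ¬link (unlinked R h hu hv u≢v (swap (subst (ColEdge β (colour σ h) (α v)) (sym eq) e)))) (w≢ ∘ sym) (inj₁ (here refl)) (extend e)))
    ... | false | false = onMark h (λ t → subst T (cong₂ _∨_ equ eqv) t) (extendMark h R hu hv u≢v)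
    new : ∀ c → BuilderWinsIn ℓ N ((α u , α v , c) ∷ β)
    new c with hueOf σ c
    ... | inj₁ refl = onGreen extend (extendGreen R) (inj₁ (here refl))
    ... | inj₂ (h , refl) = hue h

-- Weakening of positions

single : Piece → Bool
single (p , q) = p ≡ᵇ q

rename : List (ℕ × ℕ) → ℕ → ℕ
rename [] n = n
rename ((m , k) ∷ π) n = if n ≡ᵇ m then k else rename π n

-- Only single vertices may be left over, so no green edge is forgotten.
matches : List (ℕ × ℕ) → List Piece → List Piece → Bool
matches π [] ps = all single ps
matches π ((p , q) ∷ qs) ps =
  live (rename π p) ps ∧ (other (rename π p) ps ≡ᵇ rename π q) ∧ matches π qs (rest (rename π p) ps)

singles-length : ∀ {β α m} ps → T (all single ps) → Segments β α ps m → Unique m → length m ≡ length ps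
singles-length [] _ [] _ = refl
singles-length ((u , v) ∷ ps) h (_∷_ {l = l} {m = m} π S) uq
  with hu , hs ← ∧-elim {single (u , v)} h
  with refl ← ≡ᵇ⇒≡ u v hu =
  trans (length-++ l) (cong₂ _+_ (closed-length π (Unique-++ˡ l uq)) (singles-length ps hs S (Unique-++ʳ l uq)))

match : ∀ {β α m} π qs ps → T (matches π qs ps) → Segments β α ps m → Unique m →
        ∃₂ λ m′ m₀ → Segments β (α ∘ rename π) qs m′ × m ↭ m′ ++ m₀ × length m₀ + length qs ≡ length ps
match {m = m} π [] ps h S uq = [] , m , [] , ↭-refl , trans (+-identityʳ _) (singles-length ps h S uq)
match {β} {α} π ((p , q) ∷ qs) ps h S uq
  with hp , h′ ← ∧-elim {live (rename π p) ps} h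
  with eq , h″ ← ∧-elim {other (rename π p) ps ≡ᵇ rename π q} h′
  with l , m₁ , P , S₁ , perm ← pull (rename π p) ps hp S
  with m′ , m₀ , S′ , perm′ , len ← match π qs (rest (rename π p) ps) h″ S₁ (Unique-++ʳ l (Unique-resp-↭ perm uq)) =
  l ++ m′ , m₀ , subst (λ n → Path β (α (rename π p)) (α n) l) (≡ᵇ⇒≡ _ (rename π q) eq) P ∷ S′ ,
  ↭-trans perm (↭-trans (++⁺ˡ l perm′) (↭-sym (++-assoc l m′ m₀))) ,
  trans (+-suc _ _) (trans (cong suc len) (sym (length-rest (rename π p) ps hp)))

matches-live : ∀ {n} π qs ps → T (matches π qs ps) → T (live n qs) → T (live (rename π n) ps)
matches-live {n} π ((p , q) ∷ qs) ps h hn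
  with hp , h′ ← ∧-elim {live (rename π p) ps} h
  with eq , h″ ← ∧-elim {other (rename π p) ps ≡ᵇ rename π q} h′
  with ∨-elim {at n (p , q)} hn
... | inj₂ hn′ = live-rest (rename π p) ps (matches-live π qs (rest (rename π p) ps) h″ hn′)
... | inj₁ hn′ with at-elim {n} hn′
...   | inj₁ refl = hp
...   | inj₂ refl = subst (λ k → T (live k ps)) (≡ᵇ⇒≡ _ (rename π q) eq) (live-other (rename π p) ps hp)

names : List Piece → List ℕ
names [] = []
names ((p , q) ∷ ps) = p ∷ q ∷ names ps

live⇒∈ : ∀ {n} ps → T (live n ps) → n ∈ names ps
live⇒∈ {n} ((p , q) ∷ ps) h with ∨-elim {at n (p , q)} h
... | inj₂ h′ = there (there (live⇒∈ ps h′))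
... | inj₁ h′ with at-elim {n} h′
...   | inj₁ refl = here refl
...   | inj₂ refl = there (here refl)

within : Kind → Kind → Bool
within k k′ = (not (has warm k) ∨ has warm k′) ∧ (not (has cool k) ∨ has cool k′)

modus : ∀ {x y} → T (not x ∨ y) → T x → T y
modus {true} h _ = h

within-sound : ∀ k k′ h → T (within k k′) → T (has h k) → T (has h k′)
within-sound k k′ warm w = modus (proj₁ (∧-elim {not (has warm k) ∨ has warm k′} w))
within-sound k k′ cool w = modus (proj₂ (∧-elim {not (has warm k) ∨ has warm k′} w))

-- s refines t along π: s has the paths of t and possibly further single vertices,
-- its vertices are at least as full, and its links are among those of t.
compatible : List (ℕ × ℕ) → Position → Position → ℕ → ℕ → Bool
compatible π t s m n =
  (m ≡ᵇ n) ∨ (not (rename π m ≡ᵇ rename π n) ∧ (not (linked s (rename π m) (rename π n)) ∨ linked t m n))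

refines : List (ℕ × ℕ) → Position → Position → Bool
refines π t s = matches π (pieces t) (pieces s)
  ∧ all (λ m → within (kind t m) (kind s (rename π m)) ∧ all (compatible π t s m) (names (pieces t))) (names (pieces t))

-- Kinds are lower bounds and links upper bounds for the red and blue edges on the board, so both
-- may be weakened. As many vertices as pieces are dropped, which keeps `ρ`.
refined : ∀ {ℓ σ α β t s ρ} π → T (refines π t s) → Realizes ℓ σ α β s ρ → Realizes ℓ σ (α ∘ rename π) β t ρ
refined {ℓ} {σ} {α} {β} {t} {s} {ρ} π h R
  with hm , hk ← ∧-elim {matches π (pieces t) (pieces s)} h
  with m′ , m₀ , S′ , perm , len ← match π (pieces t) (pieces s) hm (segments R) (unique R) = record
  { vertices = m′
  ; segments = S′
  ; unique = Unique-++ˡ m′ (Unique-resp-↭ perm (unique R))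
  ; size = +-cancelˡ-≡ (length m₀) _ _ (begin
      length m₀ + (length m′ + ρ)      ≡⟨ sym (+-assoc (length m₀) _ ρ) ⟩
      length m₀ + length m′ + ρ        ≡⟨ cong (_+ ρ) (+-comm (length m₀) _) ⟩
      length m′ + length m₀ + ρ        ≡⟨ cong (_+ ρ) (sym (length-++ m′)) ⟩
      length (m′ ++ m₀) + ρ            ≡⟨ cong (_+ ρ) (sym (↭-length perm)) ⟩
      length (vertices R) + ρ          ≡⟨ size R ⟩
      ℓ + length (pieces s)            ≡⟨ cong (ℓ +_) (sym len) ⟩
      ℓ + (length m₀ + length (pieces t)) ≡⟨ sym (+-assoc ℓ _ _) ⟩
      ℓ + length m₀ + length (pieces t) ≡⟨ cong (_+ length (pieces t)) (+-comm ℓ _) ⟩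
      length m₀ + ℓ + length (pieces t) ≡⟨ +-assoc (length m₀) ℓ _ ⟩
      length m₀ + (ℓ + length (pieces t)) ∎)
  ; distinct = λ lm ln m≢n → distinct R (up lm) (up ln) (proj₁ (pair lm ln m≢n))
  ; touched = λ {n} h ln k → touched R h (up ln) (within-sound (kind t n) (kind s (rename π n)) h (proj₁ (∧-elim (check ln))) k)
  ; unlinked = λ {m} {n} h lm ln m≢n e →
      modus (proj₂ (pair lm ln m≢n)) (unlinked R h (up lm) (up ln) (proj₁ (pair lm ln m≢n)) e)
  }
  where
  open ≡-Reasoning
  up : ∀ {n} → T (live n (pieces t)) → T (live (rename π n) (pieces s))
  up = matches-live π (pieces t) (pieces s) hm
  check : ∀ {m} → T (live m (pieces t)) →
          T (within (kind t m) (kind s (rename π m)) ∧ all (compatible π t s m) (names (pieces t)))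
  check lm = All.lookup (Allₚ.all⁺ _ (names (pieces t)) hk) (live⇒∈ (pieces t) lm)
  pair : ∀ {m n} → T (live m (pieces t)) → T (live n (pieces t)) → m ≢ n →
         rename π m ≢ rename π n × T (not (linked s (rename π m) (rename π n)) ∨ linked t m n)
  pair {m} {n} lm ln m≢n
    with ∨-elim {m ≡ᵇ n} (All.lookup (Allₚ.all⁺ _ (names (pieces t)) (proj₂ (∧-elim {within (kind t m) (kind s (rename π m))} (check lm)))) (live⇒∈ (pieces t) ln))
  ... | inj₁ eq = ⊥-elim (m≢n (≡ᵇ⇒≡ m n eq))
  ... | inj₂ c with ∧-elim {not (rename π m ≡ᵇ rename π n)} c
  ...   | d , l = ≢-sound d , l

-- Exchanging the two hues

flipHue : Hue → Hue
flipHue warm = cool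
flipHue cool = warm

flipKind : Kind → Kind
flipKind bare = bare
flipKind full = full
flipKind (half h) = half (flipHue h)

flip : Position → Position
flip ⟨ ps ∣ ks ∣ ls ⟩ = ⟨ ps ∣ map (λ (n , k) → n , flipKind k) ks ∣ ls ⟩

kind-flip : ∀ ks n → kindIn (map (λ (n , k) → n , flipKind k) ks) n ≡ flipKind (kindIn ks n)
kind-flip [] n = refl
kind-flip ((m , k) ∷ ks) n with n ≡ᵇ m
... | true = refl
... | false = kind-flip ks n

has-flip : ∀ h k → has h (flipKind k) ≡ has (flipHue h) k
has-flip h bare = refl
has-flip h full = refl
has-flip warm (half warm) = refl
has-flip warm (half cool) = refl
has-flip cool (half warm) = refl
has-flip cool (half cool) = refl

colour-flip : ∀ σ h → colour (not σ) h ≡ colour σ (flipHue h)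
colour-flip false warm = refl
colour-flip false cool = refl
colour-flip true warm = refl
colour-flip true cool = refl

flipped : ∀ {ℓ σ α β s ρ} → Realizes ℓ σ α β s ρ → Realizes ℓ (not σ) α β (flip s) ρ
flipped {σ = σ} {α} {β} {s} R = record
  { vertices = vertices R ; segments = segments R ; unique = unique R ; size = size R ; distinct = distinct R
  ; touched = λ {n} h hn k → let w , w≢ , e = touched R (flipHue h) hn (subst T (trans (cong (has h) (kind-flip (kinds s) n)) (has-flip h (kind s n))) k)
                in w , w≢ , subst (λ c → ColEdge β c (α n) w) (sym (colour-flip σ h)) e
  ; unlinked = λ {m} {n} h hm hn m≢n e →
      unlinked R (flipHue h) hm hn m≢n (subst (λ c → ColEdge β c (α m) (α n)) (colour-flip σ h) e) }

-- Fresh vertices and closing the cycle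

update : (ℕ → Vertex) → ℕ → Vertex → ℕ → Vertex
update α n a m = if m ≡ᵇ n then a else α m

update-here : ∀ α n a → update α n a n ≡ a
update-here α n a with n ≡ᵇ n | ≡ᵇ-refl n
... | true | _ = refl

update-there : ∀ {α m n a} → m ≢ n → update α n a m ≡ α m
update-there {m = m} {n} m≢n with m ≡ᵇ n in eq
... | true = ⊥-elim (m≢n (≡ᵇ⇒≡ m n (subst T (sym eq) tt)))
... | false = refl

∈-path : ∀ {β a z l} → Path β a z l → a ∈ l
∈-path stop = here refl
∈-path (_ ◂ _) = here refl

live⇒vertex : ∀ {β α m n} ps → Segments β α ps m → T (live n ps) → α n ∈ m
live⇒vertex {n = n} ((u , v) ∷ ps) (_∷_ {l = l} π S) h with ∨-elim {at n (u , v)} h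
... | inj₂ h′ = ∈-++⁺ʳ l (live⇒vertex ps S h′)
... | inj₁ h′ with at-elim {n} h′
...   | inj₁ refl = ∈-++⁺ˡ (∈-path π)
...   | inj₂ refl = ∈-++⁺ˡ (last∈ π)

sprouted : ∀ {ℓ σ α β s ρ} n → T (not (live n (pieces s))) → Realizes ℓ σ α β s ρ →
           ∃ λ α′ → Realizes ℓ σ α′ β (sprout n s) ρ
sprouted {ℓ} {σ} {α} {β} {s} {ρ} n dead R = α′ , record
  { vertices = a ∷ vertices R
  ; segments = subst (λ c → Path β c c (a ∷ [])) (sym here′) stop ∷ relabel (pieces s) (λ m hm → sym (there′ hm)) (segments R)
  ; unique = All.map (λ le eq → <-irrefl eq (s≤s le)) (xs≤max (bound β) (vertices R)) `∷ unique R
  ; size = trans (cong suc (size R)) (sym (+-suc ℓ _))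
  ; distinct = distinct′ ; touched = touched′ ; unlinked = unlinked′ }
  where
  -- A single vertex need not occur on the board, so `a` must exceed the path vertices as well as
  -- `bound β`.
  a = suc (max (bound β) (vertices R))
  α′ = update α n a
  _`∷_ : ∀ {x xs} → All (λ y → y ≢ x) xs → Unique xs → Unique (x ∷ xs)
  p `∷ u = All.map (_∘ sym) p ∷ u
  here′ : α′ n ≡ a
  here′ = update-here α n a
  there′ : ∀ {m} → T (live m (pieces s)) → α′ m ≡ α m
  there′ hm = update-there {α} {a = a} λ { refl → not-elim dead hm }
  older : ∀ {m} → m ≢ n → T (live m (pieces (sprout n s))) → T (live m (pieces s))
  older {m} m≢n h with ∨-elim {at m (n , n)} h
  ... | inj₂ h′ = h′
  ... | inj₁ h′ with at-elim {m} h′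
  ...   | inj₁ eq = ⊥-elim (m≢n eq)
  ...   | inj₂ eq = ⊥-elim (m≢n eq)
  beyond : ∀ {m} → T (live m (pieces s)) → a ≢ α m
  beyond hm eq = <-irrefl (sym eq) (s≤s (All.lookup (xs≤max (bound β) (vertices R)) (live⇒vertex (pieces s) (segments R) hm)))
  isolated : ∀ {c v} → ¬ ColEdge β c a v
  isolated e = <-irrefl refl (≤-trans (s≤s (⊥≤max (bound β) (vertices R))) (colEdge-bounded e))
  distinct′ : ∀ {m k} → T (live m (pieces (sprout n s))) → T (live k (pieces (sprout n s))) → m ≢ k → α′ m ≢ α′ k
  distinct′ {m} {k} hm hk m≢k eq with m ≟ n | k ≟ n
  ... | yes refl | yes refl = m≢k refl
  ... | yes refl | no k≢n = beyond (older k≢n hk) (trans (sym here′) (trans eq (there′ (older k≢n hk))))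
  ... | no m≢n | yes refl = beyond (older m≢n hm) (trans (sym here′) (trans (sym eq) (there′ (older m≢n hm))))
  ... | no m≢n | no k≢n = distinct R (older m≢n hm) (older k≢n hk) m≢k
          (trans (sym (there′ (older m≢n hm))) (trans eq (there′ (older k≢n hk))))
  touched′ : ∀ {m} h → T (live m (pieces (sprout n s))) → T (has h (kind (sprout n s) m)) →
             ∃ λ w → w ≢ α′ m × ColEdge β (colour σ h) (α′ m) w
  touched′ {m} h hm k with m ≟ n
  ... | yes refl = ⊥-elim (subst (T ∘ has h) (kind-here n bare (kinds s)) k)
  ... | no m≢n rewrite there′ (older m≢n hm) = touched R h (older m≢n hm) (subst (T ∘ has h) (kind-there bare (kinds s) m≢n) k)
  unlinked′ : ∀ {m k} h → T (live m (pieces (sprout n s))) → T (live k (pieces (sprout n s))) → m ≢ k →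
              ColEdge β (colour σ h) (α′ m) (α′ k) → T (linked s m k)
  unlinked′ {m} {k} h hm hk m≢k e with m ≟ n | k ≟ n
  ... | yes refl | _ = ⊥-elim (isolated (subst (λ x → ColEdge β (colour σ h) x (α′ k)) here′ e))
  ... | no _ | yes refl = ⊥-elim (isolated (swap (subst (ColEdge β (colour σ h) (α′ m)) here′ e)))
  ... | no m≢n | no k≢n = unlinked R h (older m≢n hm) (older k≢n hk) m≢k
          (subst₂ (ColEdge β (colour σ h)) (there′ (older m≢n hm)) (there′ (older k≢n hk)) e)

-- All other pieces have one vertex each, so with one edge missing the path from `u` to `v` has
-- exactly `ℓ` vertices.
closes : ∀ {ℓ σ α β s} u v → T (matches [] ((u , v) ∷ []) (pieces s)) → Realizes ℓ σ α β s 1 →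
         ColEdge β green (α u) (α v) → Won ℓ β
closes {ℓ} {β = β} {s = s} u v h R g with match [] ((u , v) ∷ []) (pieces s) h (segments R) (unique R)
... | _ , m₀ , (_∷_ {l = l} π []) , perm , len = inj₂ (inj₂ (subst (λ n → HasCycle green n β) length≡ℓ
      (cycle π (Unique-++ˡ l (Unique-++ˡ (l ++ []) (Unique-resp-↭ perm (unique R)))) (swap g))))
  where
  open ≡-Reasoning
  length≡ℓ : length l ≡ ℓ
  length≡ℓ = +-cancelʳ-≡ (length (pieces s)) _ _ (begin
    length l + length (pieces s)        ≡⟨ cong (length l +_) (sym len) ⟩
    length l + (length m₀ + 1)          ≡⟨ sym (+-assoc (length l) _ 1) ⟩
    length l + length m₀ + 1            ≡⟨ cong (λ n → n + length m₀ + 1) (sym (+-identityʳ (length l))) ⟩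
    length l + 0 + length m₀ + 1        ≡⟨ cong (λ n → n + length m₀ + 1) (sym (length-++ l)) ⟩
    length (l ++ []) + length m₀ + 1    ≡⟨ cong (_+ 1) (sym (length-++ (l ++ []))) ⟩
    length ((l ++ []) ++ m₀) + 1        ≡⟨ cong (_+ 1) (sym (↭-length perm)) ⟩
    length (vertices R) + 1             ≡⟨ size R ⟩
    ℓ + length (pieces s)               ∎)

-- Builder's moves

separate : ℕ → ℕ → Position → Bool
separate u v s = live u (pieces s) ∧ live v (rest u (pieces s)) ∧ not (u ≡ᵇ v) ∧ not (linked s u v)

-- For a concrete position the Boolean computes, and an impossible answer is dealt with by `tt`.
Unless : Bool → Set → Set
Unless true  _ = ⊤
Unless false A = A

unless : ∀ {x A} → Unless x A → ¬ T x → A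
unless {true} _ ¬x = ⊥-elim (¬x tt)
unless {false} a _ = a

module _ (ℓ : ℕ) where

  -- Builder wins if ρ more green edges are needed and W edges may be wasted.
  record Force (s : Position) (ρ W : ℕ) : Set where
    constructor forcing
    field win : ∀ {σ α β} → Realizes ℓ σ α β s ρ → BuilderWinsIn ℓ (ρ + W) β
  open Force public

module _ {ℓ : ℕ} where

  more : ∀ {s ρ W} → Force ℓ s ρ W → Force ℓ s ρ (suc W)
  more {ρ = ρ} {W} F = forcing λ {_} {_} {β} R → subst (λ n → BuilderWinsIn ℓ n β) (sym (+-suc ρ W)) (wins-suc (ρ + W) (win F R))

  -- The side condition is Boolean so that for concrete positions it is checked by evaluation; the
  -- moves below use the same device.
  via : ∀ {t s ρ W} π {_ : T (refines π t s)} → Force ℓ t ρ W → Force ℓ s ρ W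
  via π {h} F = forcing λ R → win F (refined π h R)

  swapped : ∀ {s ρ W} → Force ℓ (flip s) ρ W → Force ℓ s ρ W
  swapped F = forcing λ R → win F (flipped R)

  new : ∀ {s ρ W} n {_ : T (not (live n (pieces s)))} → Force ℓ (sprout n s) ρ W → Force ℓ s ρ W
  new n {h} F = forcing λ R → win F (proj₂ (sprouted n h R))

  -- Of the `ρ + W` rounds left, a red or blue answer is charged to `W` and a green one to `ρ`.
  query : ∀ {s ρ W} u v {_ : T (separate u v s)} →
          Unless (blocked warm u v s) (Force ℓ (mark warm u v s) (suc ρ) W) →
          Unless (blocked cool u v s) (Force ℓ (mark cool u v s) (suc ρ) W) →
          Force ℓ (join u v s) ρ (suc W) → Force ℓ s (suc ρ) (suc W)
  query {s} {ρ} {W} u v {h} Fw Fc Fg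
    with hu , h′ ← ∧-elim {live u (pieces s)} h
    with hv , h″ ← ∧-elim {live v (rest u (pieces s))} h′
    with d , l ← ∧-elim {not (u ≡ᵇ v)} h″ = forcing λ R →
      draw u v R hu (live-rest u (pieces s) hv) (≢-sound d) (not-elim l)
        (λ { warm ¬b R′ → move (win (unless Fw ¬b) R′) ; cool ¬b R′ → move (win (unless Fc ¬b) R′) })
        (λ _ R′ g → win Fg (joined u v R′ hu hv g))
    where
    move : ∀ {β} → BuilderWinsIn ℓ (suc ρ + W) β → BuilderWinsIn ℓ (ρ + suc W) β
    move {β} = subst (λ n → BuilderWinsIn ℓ n β) (sym (+-suc ρ W))

  forced : ∀ {s ρ W} u v {_ : T (blocked warm u v s ∧ blocked cool u v s ∧ separate u v s)} →
           Force ℓ (join u v s) ρ W → Force ℓ s (suc ρ) W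
  forced {s} {ρ} {W} u v {h} F
    with bw , h₁ ← ∧-elim {blocked warm u v s} h
    with bc , h₂ ← ∧-elim {blocked cool u v s} h₁
    with hu , h′ ← ∧-elim {live u (pieces s)} h₂
    with hv , h″ ← ∧-elim {live v (rest u (pieces s))} h′
    with d , l ← ∧-elim {not (u ≡ᵇ v)} h″ = forcing λ R →
      draw u v R hu (live-rest u (pieces s) hv) (≢-sound d) (not-elim l)
        (λ { warm ¬b _ → ⊥-elim (¬b bw) ; cool ¬b _ → ⊥-elim (¬b bc) })
        (λ _ R′ g → win F (joined u v R′ hu hv g))

  -- Here `u` and `v` are the two ends of one piece, so `separate` cannot be asked for.
  close : ∀ {s W} u v {_ : T (blocked warm u v s ∧ blocked cool u v s ∧ live u (pieces s) ∧ live v (pieces s)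
            ∧ not (u ≡ᵇ v) ∧ not (linked s u v) ∧ matches [] ((u , v) ∷ []) (pieces s))} → Force ℓ s 1 W
  close {s} {W} u v {h}
    with bw , h₁ ← ∧-elim {blocked warm u v s} h
    with bc , h₂ ← ∧-elim {blocked cool u v s} h₁
    with hu , h₃ ← ∧-elim {live u (pieces s)} h₂
    with hv , h₄ ← ∧-elim {live v (pieces s)} h₃
    with d , h₅ ← ∧-elim {not (u ≡ᵇ v)} h₄
    with l , hm ← ∧-elim {not (linked s u v)} h₅ = forcing λ R →
      draw u v R hu hv (≢-sound d) (not-elim l)
        (λ { warm ¬b _ → ⊥-elim (¬b bw) ; cool ¬b _ → ⊥-elim (¬b bc) })
        (λ _ R′ g → won⇒wins W (closes u v hm R′ g))

  -- The vertex n is tried as the last one: if n sends a green edge to x but not to y,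
  -- both edges at n are given up.
  probe : ∀ {s W} x y n {_ : T (not (live n (pieces s)) ∧ separate x n (sprout n s) ∧ separate n y (sprout n s)
            ∧ matches [] ((n , y) ∷ []) (pieces (join x n (sprout n s))))} →
          Unless (blocked warm x n (sprout n s)) (Force ℓ (mark warm x n (sprout n s)) 2 (suc W)) →
          Unless (blocked cool x n (sprout n s)) (Force ℓ (mark cool x n (sprout n s)) 2 (suc W)) →
          Unless (blocked warm n y (sprout n s)) (Force ℓ (mark warm n y (sprout n s)) 2 W) →
          Unless (blocked cool n y (sprout n s)) (Force ℓ (mark cool n y (sprout n s)) 2 W) →
          Force ℓ s 2 (suc (suc W))
  probe {s} {W} x y n {h} Fw Fc Gw Gc
    with dead , h₁ ← ∧-elim {not (live n (pieces s))} h
    with sx , h₂ ← ∧-elim {separate x n (sprout n s)} h₁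
    with sy , hm ← ∧-elim {separate n y (sprout n s)} h₂
    with hx , hx′ ← ∧-elim {live x (pieces (sprout n s))} sx
    with hn , hx″ ← ∧-elim {live n (rest x (pieces (sprout n s)))} hx′
    with dx , lx ← ∧-elim {not (x ≡ᵇ n)} hx″
    with hn′ , hy′ ← ∧-elim {live n (pieces (sprout n s))} sy
    with hy , hy″ ← ∧-elim {live y (rest n (pieces (sprout n s)))} hy′
    with dy , ly ← ∧-elim {not (n ≡ᵇ y)} hy″ = forcing λ R →
      draw {N = 3 + W} x n (proj₂ (sprouted n dead R)) hx hn′ (≢-sound dx) (not-elim lx)
        (λ { warm ¬b R′ → win (unless Fw ¬b) R′ ; cool ¬b R′ → win (unless Fc ¬b) R′ })
        -- The green edge at `n` is not joined yet: should `n y` be refused, the position still has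
        -- two edges missing.
        (λ _ R′ g → draw {N = 2 + W} n y R′ hn′ (live-rest n (pieces (sprout n s)) hy) (≢-sound dy) (not-elim ly)
          (λ { warm ¬b R″ → win (unless Gw ¬b) R″ ; cool ¬b R″ → win (unless Gc ¬b) R″ })
          (λ keep R″ g′ → won⇒wins (2 + W) (closes n y hm (joined x n R″ hx hn (keep g)) g′)))

-- The strategy

x y f e d u v w s z : ℕ
x = 0
y = 1
f = 2
e = 3
d = 4
u = 5
v = 6
w = 7
s = 8
z = 9

-- Two capitals denote a path by the kinds of its ends (bare, half, full), and h a single half vertex.
BF BF+h HF FF BF∥BB BF∥BB+h BF∥BH HF+h HF∥BB+h HF∥BH BB BB+h BH BH+h : Position
BF      = ⟨ (x , f) ∷ [] ∣ (f , full) ∷ [] ∣ [] ⟩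
BF+h    = ⟨ (x , f) ∷ (e , e) ∷ [] ∣ (f , full) ∷ (e , half warm) ∷ [] ∣ (f , e) ∷ [] ⟩
HF      = ⟨ (y , f) ∷ [] ∣ (y , half warm) ∷ (f , full) ∷ [] ∣ (y , f) ∷ [] ⟩
FF      = ⟨ (y , f) ∷ [] ∣ (y , full) ∷ (f , full) ∷ [] ∣ (y , f) ∷ [] ⟩
BF∥BB   = ⟨ (x , f) ∷ (u , v) ∷ [] ∣ (f , full) ∷ [] ∣ [] ⟩
BF∥BB+h = ⟨ (x , f) ∷ (u , v) ∷ (e , e) ∷ [] ∣ (f , full) ∷ (e , half warm) ∷ [] ∣ (f , e) ∷ [] ⟩
BF∥BH   = ⟨ (x , f) ∷ (v , e) ∷ [] ∣ (f , full) ∷ (e , half warm) ∷ [] ∣ (f , e) ∷ [] ⟩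
HF+h    = ⟨ (y , f) ∷ (e , e) ∷ [] ∣ (y , half warm) ∷ (f , full) ∷ (e , half warm) ∷ [] ∣ (y , e) ∷ [] ⟩
HF∥BB+h = ⟨ (y , f) ∷ (u , v) ∷ (e , e) ∷ [] ∣ (y , half warm) ∷ (f , full) ∷ (e , half warm) ∷ [] ∣ (y , e) ∷ [] ⟩
HF∥BH   = ⟨ (y , f) ∷ (u , e) ∷ [] ∣ (y , half warm) ∷ (f , full) ∷ (e , half warm) ∷ [] ∣ (y , e) ∷ [] ⟩
BB      = ⟨ (x , y) ∷ [] ∣ [] ∣ [] ⟩
BB+h    = ⟨ (x , y) ∷ (e , e) ∷ [] ∣ (e , half warm) ∷ [] ∣ [] ⟩
BH      = ⟨ (x , y) ∷ [] ∣ (y , half warm) ∷ [] ∣ [] ⟩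
BH+h    = ⟨ (x , y) ∷ (e , e) ∷ [] ∣ (y , half warm) ∷ (e , half warm) ∷ [] ∣ (y , e) ∷ [] ⟩

-- Up to exchanging the hues one of the two half vertices is warm; the argument is the hue of the
-- other.
BF+2h HH : Hue → Position
BF+2h h = ⟨ (x , f) ∷ (d , d) ∷ (e , e) ∷ [] ∣ (f , full) ∷ (d , half warm) ∷ (e , half h) ∷ [] ∣ (f , d) ∷ (f , e) ∷ [] ⟩
HH h    = ⟨ (x , y) ∷ [] ∣ (x , half h) ∷ (y , half warm) ∷ [] ∣ (x , y) ∷ [] ⟩

double : ℕ → ℕ
double zero = zero
double (suc n) = suc (suc (double n))

-- Paths with at least one full end

module _ {ℓ : ℕ} where

  -- The ends may already share a red or blue edge, so a fresh vertex is inserted between them; both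
  -- its edges are forced.
  FF-2 : ∀ {W} → Force ℓ FF 2 W
  FF-2 = new z (forced f z (close z y))

  HF-2-1 : Force ℓ HF 2 1
  HF-2-1 = new u (query y u tt (via [] FF-2) (close u f))

  -- A refusal makes `y` full and `u` half. Attaching `u` to `f` makes the refused edge connect the
  -- two ends, which is why `HF` has a link.
  HF-step-HF : ∀ {ρ W} → Force ℓ BF ρ (suc W) → Force ℓ HF ρ W → Force ℓ HF (suc ρ) (suc W)
  HF-step-HF F G = new u (query y u tt
    (forced f u (swapped (via ((y , u) ∷ (f , y) ∷ []) G)))
    (via ((x , u) ∷ []) F))

  -- After a refusal `f` is extended by a fresh vertex instead, and the half vertex `u` is kept in
  -- reserve.
  HF-step-BF+h : ∀ {ρ W} → Force ℓ BF ρ (suc W) → Force ℓ BF+h ρ W → Force ℓ HF (suc ρ) (suc W)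
  HF-step-BF+h F G = new u (query y u tt
    (new z (forced f z (swapped (via ((x , z) ∷ (f , y) ∷ (e , u) ∷ []) G))))
    (via ((x , u) ∷ []) F))

  BF-step : ∀ {ρ W} → Force ℓ BF ρ (suc W) → Force ℓ HF (suc ρ) W → Force ℓ BF (suc ρ) (suc W)
  BF-step F G = new u (query x u (via ((y , x) ∷ []) G) (swapped (via ((y , x) ∷ []) G)) (via ((x , u) ∷ []) F))

  BF-2-2 : Force ℓ BF 2 2
  BF-2-2 = new u (query x u (via ((y , x) ∷ []) HF-2-1) (swapped (via ((y , x) ∷ []) HF-2-1)) (close u f))

  BF-4-3 : Force ℓ BF∥BB 3 3 → Force ℓ BF+h 4 2 → Force ℓ BF 4 3
  BF-4-3 F G = new u (new v (query u v (via ((e , u) ∷ []) G) (swapped (via ((e , u) ∷ []) G)) (via [] F)))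

  HF+h-step : ∀ {ρ W} → Force ℓ BF+h ρ (suc W) → Force ℓ (BF+2h cool) ρ W → Force ℓ HF+h (suc ρ) (suc W)
  HF+h-step F G = new s (query y s tt
    (new z (forced f z (via ((x , z) ∷ (f , y) ∷ (d , e) ∷ (e , s) ∷ []) G)))
    (via ((x , s) ∷ []) F))

  BF-step-HF+h : ∀ {ρ W} → Force ℓ BF ρ (suc W) → Force ℓ HF+h (suc ρ) W → Force ℓ BF (suc ρ) (suc W)
  BF-step-HF+h F G = new u (query x u
    (via ((y , x) ∷ (e , u) ∷ []) G) (swapped (via ((y , x) ∷ (e , u) ∷ []) G)) (via ((x , u) ∷ []) F))

  -- A refusal makes `e` full, and `z` connects it to `f` by two forced edges: one wasted edge buys
  -- two green ones.
  BF+h-step-HF : ∀ {ρ W} → Force ℓ HF (suc ρ) (suc W) → Force ℓ HF ρ W → Force ℓ BF+h (2 + ρ) (suc W)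
  BF+h-step-HF F G = query e x tt
    (new z (forced f z (forced z e (swapped (via ((y , x) ∷ (f , e) ∷ []) G)))))
    (via ((y , e) ∷ []) F)

  -- Builder offers `e` two edges. A refusal of either makes `e` full, and it is connected to `f`
  -- through `z` or `v`, with two edges gained in all; two green answers make `e` the middle of a
  -- second path.
  BF+h-step : ∀ {ρ W} → Force ℓ BF∥BB ρ (suc W) → Force ℓ BF+h ρ W → Force ℓ BF+h (2 + ρ) (suc W)
  BF+h-step F G = new v (query e v tt
    (new z (forced f z (forced z e (swapped (via ((f , e) ∷ (e , v) ∷ []) G)))))
    (new u (query e u tt
      (forced f v (swapped (via ((f , e) ∷ (e , u) ∷ []) G)))
      (via [] F))))

  -- As in `BF+h-step`, with `d` untouched. A refusal gives the new half vertex the hue that `e`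
  -- lacked, hence `flipHue`.
  BF+2h-step : ∀ {ρ W} h → Force ℓ BF∥BB+h ρ (suc W) → Force ℓ (BF+2h (flipHue h)) ρ W →
               Force ℓ (BF+2h h) (2 + ρ) (suc W)
  BF+2h-step warm F G = new v (query e v tt
    (new z (forced f z (forced z e (via ((f , e) ∷ (e , v) ∷ []) G))))
    (new u (query e u tt
      (forced f v (via ((f , e) ∷ (e , u) ∷ []) G))
      (via ((e , d) ∷ []) F))))
  BF+2h-step cool F G = new v (query e v
    (new z (forced f z (forced z e (via ((f , e) ∷ (e , v) ∷ []) G)))) tt
    (new u (query e u
      (forced f v (via ((f , e) ∷ (e , u) ∷ []) G)) tt
      (via ((e , d) ∷ []) F))))

  BF+2h-5-2 : ∀ h → Force ℓ HF 3 2 → Force ℓ (BF+2h h) 5 2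
  BF+2h-5-2 warm F = query e x tt
    (forced d x (new z (forced z e (forced z f (via ((y , d) ∷ (f , e) ∷ []) HF-2-1)))))
    (query e d tt
      (new z (forced d z (forced z f (via ((y , d) ∷ (f , e) ∷ []) FF-2))))
      (via ((y , d) ∷ []) F))
  -- The two half vertices have different hues, so their edge is forced.
  BF+2h-5-2 cool F = forced d e (query d x tt
    (new s (query x s (forced s e (forced s f (via ((y , d) ∷ (f , x) ∷ []) FF-2))) tt
      (forced s d (swapped (via ((y , e) ∷ []) HF-2-1)))))
    (swapped (via ((y , e) ∷ []) F)))

  -- A refusal makes `e` full, and `e` then joins the two paths by two forced edges.
  BF∥BB+h-step : ∀ {ρ W} → Force ℓ BF∥BH (suc ρ) (suc W) → Force ℓ HF ρ W → Force ℓ BF∥BB+h (2 + ρ) (suc W)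
  BF∥BB+h-step F G = query e v tt
    (forced u e (forced e x (swapped (via ((y , v) ∷ []) G))))
    (via ((v , u) ∷ []) F)

  -- The paths are joined either at `e x` or, after its refusal, at `v f`.
  BF∥BH-step : ∀ {ρ W} → Force ℓ BF ρ (suc W) → Force ℓ HF ρ W → Force ℓ BF∥BH (suc ρ) (suc W)
  BF∥BH-step F G = query e x tt
    (forced v f (swapped (via ((y , x) ∷ (f , e) ∷ []) G)))
    (via ((x , v) ∷ []) F)

  HF∥BB+h-step : ∀ {ρ W} → Force ℓ BF∥BB+h ρ (suc W) → Force ℓ (BF+2h cool) ρ W → Force ℓ HF∥BB+h (suc ρ) (suc W)
  HF∥BB+h-step F G = new s (query y s tt
    (forced y v (via ((x , u) ∷ (d , e) ∷ (e , s) ∷ []) G))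
    (via ((x , s) ∷ []) F))

  BF∥BB-step : ∀ {ρ W} → Force ℓ BF∥BB ρ (suc W) → Force ℓ HF∥BB+h (suc ρ) W → Force ℓ BF∥BB (suc ρ) (suc W)
  BF∥BB-step F G = new w (query x w
    (via ((y , x) ∷ (e , w) ∷ []) G) (swapped (via ((y , x) ∷ (e , w) ∷ []) G)) (via ((x , w) ∷ []) F))

  BF∥BB-step-HF∥BH : ∀ {ρ W} → Force ℓ BF ρ (suc W) → Force ℓ HF∥BH (suc ρ) W → Force ℓ BF∥BB (suc ρ) (suc W)
  BF∥BB-step-HF∥BH F G = query x v
    (via ((y , x) ∷ (e , v) ∷ []) G) (swapped (via ((y , x) ∷ (e , v) ∷ []) G)) (via ((x , u) ∷ []) F)

  HF∥BH-3-2 : Force ℓ HF∥BH 3 2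
  HF∥BH-3-2 = query u y tt
    (forced e f (swapped (via ((y , u) ∷ (f , y) ∷ []) HF-2-1)))
    (more (via ((y , e) ∷ []) HF-2-1))

  HF∥BH-4-2 : Force ℓ HF∥BH 4 2
  HF∥BH-4-2 = new s (query e s tt
    (forced s y (forced u f (swapped (via ((y , s) ∷ (f , e) ∷ []) HF-2-1))))
    (query s y tt
      (forced u y (swapped (via ((y , s) ∷ []) HF-2-1)))
      (via ((x , u) ∷ []) BF-2-2)))

  HF∥BH-step : ∀ {ρ W} → Force ℓ BF∥BH ρ (suc W) → Force ℓ BF+h ρ W → Force ℓ HF∥BH (suc ρ) (suc W)
  HF∥BH-step F G = new s (query y s tt
    (forced e f (swapped (via ((x , u) ∷ (f , y) ∷ (e , s) ∷ []) G)))
    (via ((x , s) ∷ (v , u) ∷ []) F))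

  -- There is no slack in these bounds to lose a wasted edge, which is why the parity of ρ matters.
  BF-even       : ∀ n → Force ℓ BF (2 + double n) (2 + n)
  BF-odd        : ∀ n → Force ℓ BF (3 + double n) (3 + n)
  HF-even       : ∀ n → Force ℓ HF (2 + double n) (2 + n)
  HF-odd        : ∀ n → Force ℓ HF (3 + double n) (2 + n)
  BF+h-even     : ∀ n → Force ℓ BF+h (4 + double n) (2 + n)
  BF+2h-odd     : ∀ h n → Force ℓ (BF+2h h) (5 + double n) (2 + n)
  BF∥BH-even    : ∀ n → Force ℓ BF∥BH (4 + double n) (3 + n)
  BF∥BB+h-odd   : ∀ n → Force ℓ BF∥BB+h (5 + double n) (3 + n)
  BF∥BB-even    : ∀ n → Force ℓ BF∥BB (4 + double n) (3 + n)
  BF∥BB-odd     : ∀ n → Force ℓ BF∥BB (3 + double n) (3 + n)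

  BF-even zero = BF-2-2
  -- The next clause would lead to `BF+2h` with three missing edges, below the range of `BF+2h-odd`;
  -- a second path is tried instead.
  BF-even (suc zero) = BF-4-3 (BF∥BB-odd zero) (BF+h-even zero)
  BF-even (suc (suc n)) = BF-step-HF+h (BF-odd (suc n))
    (HF+h-step (BF+h-step-HF (HF-even (suc n)) (HF-odd n)) (BF+2h-odd cool n))
  BF-odd n = BF-step (more (BF-even n)) (HF-odd n)
  HF-even zero = more HF-2-1
  HF-even (suc n) = HF-step-HF (BF-odd n) (HF-odd n)
  HF-odd zero = HF-step-HF (BF-even zero) HF-2-1
  HF-odd (suc n) = HF-step-BF+h (BF-even (suc n)) (BF+h-even n)
  BF+h-even zero = BF+h-step-HF (HF-odd zero) HF-2-1
  BF+h-even (suc n) = BF+h-step (BF∥BB-even n) (BF+h-even n)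
  BF+2h-odd h zero = BF+2h-5-2 h (HF-odd zero)
  BF+2h-odd h (suc n) = BF+2h-step h (BF∥BB+h-odd n) (BF+2h-odd (flipHue h) n)
  BF∥BH-even n = BF∥BH-step (BF-odd n) (HF-odd n)
  BF∥BB+h-odd n = BF∥BB+h-step (BF∥BH-even n) (HF-odd n)
  BF∥BB-even zero = BF∥BB-step-HF∥BH (BF-odd zero) HF∥BH-4-2
  BF∥BB-even (suc n) = BF∥BB-step (BF∥BB-odd (suc n)) (HF∥BB+h-step (BF∥BB+h-odd n) (BF+2h-odd cool n))
  BF∥BB-odd zero = BF∥BB-step-HF∥BH (more (BF-even zero)) HF∥BH-3-2
  BF∥BB-odd (suc n) = BF∥BB-step-HF∥BH (more (BF-even (suc n))) (HF∥BH-step (BF∥BH-even n) (BF+h-even n))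

-- Paths with two bare ends, and the whole game

∅ : Position
∅ = ⟨ [] ∣ [] ∣ [] ⟩

parity : ∀ n → (∃ λ m → n ≡ double m) ⊎ (∃ λ m → n ≡ suc (double m))
parity zero = inj₁ (0 , refl)
parity (suc n) with parity n
... | inj₁ (m , refl) = inj₂ (m , refl)
... | inj₂ (m , refl) = inj₁ (suc m , refl)

halve-≤ : ∀ {m n} → double m ≤ suc (double n) → m ≤ n
halve-≤ {zero} _ = z≤n
halve-≤ {suc m} {zero} (s≤s ())
halve-≤ {suc m} {suc n} (s≤s (s≤s le)) = s≤s (halve-≤ le)

module _ {ℓ : ℕ} where

  HH-2-3 : ∀ h → Force ℓ (HH h) 2 3
  HH-2-3 warm = probe x y w
    tt (via ((f , x) ∷ []) (more HF-2-1))
    tt (via ((y , x) ∷ (f , y) ∷ []) HF-2-1)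
  HH-2-3 cool = probe x y w
    (via ((f , x) ∷ []) (more HF-2-1)) tt
    tt (swapped (via ((y , x) ∷ (f , y) ∷ []) HF-2-1))

  BH-2-4 : Force ℓ BH 2 4
  BH-2-4 = probe x y w (via [] (HH-2-3 warm)) (via [] (HH-2-3 cool)) tt (via ((f , y) ∷ []) BF-2-2)

  -- A failed probe costs at most two wasted edges and gives an end a colour: 6 for `BB`, 4 for
  -- `BH`, then 3 for `HH` or 2 for `BF`.
  BB-2-6 : Force ℓ BB 2 6
  BB-2-6 = probe x y w
    (via ((x , y) ∷ (y , x) ∷ []) (more BH-2-4)) (swapped (via ((x , y) ∷ (y , x) ∷ []) (more BH-2-4)))
    (via [] BH-2-4) (swapped (via [] BH-2-4))

  HH-step : ∀ {ρ W} → Force ℓ BH ρ (suc W) → Force ℓ HF (suc ρ) W → Force ℓ (HH warm) (suc ρ) (suc W)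
  HH-step F G = new s (query x s tt (via ((f , x) ∷ []) G) (via ((x , s) ∷ []) F))

  -- A refused `x u` gives `x` and `u` the same hue. If `y` has the other one, `u y` is forced;
  -- otherwise it is offered, and a second refusal makes `y` full.
  BH-step-HH : ∀ {ρ W} → Force ℓ BH ρ (2 + W) → Force ℓ (HH warm) ρ (suc W) → Force ℓ HF (suc ρ) W →
               Force ℓ BH (suc ρ) (2 + W)
  BH-step-HH F G H = new u (query x u
    (query u y tt (via ((y , x) ∷ (f , y) ∷ []) H) (via ((y , u) ∷ []) G))
    (forced u y (swapped (via ((y , u) ∷ []) G)))
    (via ((x , u) ∷ []) F))

  BH-3-4 : Force ℓ BH 3 4
  BH-3-4 = BH-step-HH BH-2-4 (HH-2-3 warm) (HF-odd 0)

  BH-4-5 : Force ℓ BH 4 5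
  BH-4-5 = BH-step-HH (more BH-3-4) (HH-step BH-2-4 (more (HF-odd 0))) (HF-even 1)

  BH-5-5 : Force ℓ BH 5 5
  BH-5-5 = BH-step-HH BH-4-5 (HH-step BH-3-4 (HF-even 1)) (HF-odd 1)

  BB-step : ∀ {ρ W} → Force ℓ BB ρ (suc W) → Force ℓ BH+h (suc ρ) W → Force ℓ BB (suc ρ) (suc W)
  BB-step F G = new u (query y u
    (via ((e , u) ∷ []) G) (swapped (via ((e , u) ∷ []) G)) (via ((y , u) ∷ []) F))

  BH+h-step : ∀ {ρ W} → Force ℓ BB+h ρ (suc W) → Force ℓ (BF+2h cool) (suc ρ) W → Force ℓ BH+h (suc ρ) (suc W)
  BH+h-step F G = new u (query y u tt
    (via ((f , y) ∷ (d , e) ∷ (e , u) ∷ []) G) (via ((y , u) ∷ []) F))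

  BB+h-step : ∀ {ρ W} → Force ℓ BH ρ (suc W) → Force ℓ HF ρ W → Force ℓ BB+h (suc ρ) (suc W)
  BB+h-step F G = query e y tt (forced x e (swapped (via ((f , e) ∷ []) G))) (via ((y , e) ∷ []) F)

  BH-step : ∀ {ρ W} → Force ℓ BB ρ (suc W) → Force ℓ BF+h (suc ρ) W → Force ℓ BH (suc ρ) (suc W)
  BH-step F G = new s (query y s tt (swapped (via ((f , y) ∷ (e , s) ∷ []) G)) (via ((y , s) ∷ []) F))

  weaken : ∀ {t ρ W W′} → W ≤ W′ → Force ℓ t ρ W → Force ℓ t ρ W′
  weaken {W′ = zero} z≤n F = F
  weaken {W = W} {suc W′} le F with W ≤? W′
  ... | yes le′ = more (weaken le′ F)
  ... | no ¬le rewrite ≤-antisym le (≰⇒> ¬le) = F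

  -- Halving rounds in the right direction, so one inequality covers both parities without loss.
  HF-any : ∀ {ρ W} → 3 + ρ ≤ double W → Force ℓ HF (2 + ρ) W
  HF-any {ρ} le with parity ρ
  ... | inj₁ (n , refl) = weaken (halve-≤ (s≤s le)) (HF-even n)
  ... | inj₂ (n , refl) = weaken (halve-≤ (m≤n⇒m≤1+n le)) (HF-odd n)

  BF+h-any : ∀ {ρ W} → 4 + ρ ≤ double W → Force ℓ BF+h (4 + ρ) W
  BF+h-any {ρ} le with parity ρ
  ... | inj₁ (n , refl) = weaken (halve-≤ (m≤n⇒m≤1+n le)) (BF+h-even n)
  ... | inj₂ (n , refl) = weaken (halve-≤ (s≤s le)) (BF+h-step-HF (HF-even (suc n)) (HF-odd n))

  BF+2h-any : ∀ {ρ W} → 3 + ρ ≤ double W → Force ℓ (BF+2h cool) (4 + ρ) W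
  BF+2h-any {ρ} le with parity ρ
  -- For even `ρ` the cool vertex is dropped.
  ... | inj₁ (n , refl) = weaken (halve-≤ (s≤s le)) (via ((e , d) ∷ []) (BF+h-even n))
  ... | inj₂ (n , refl) = weaken (halve-≤ (m≤n⇒m≤1+n le)) (BF+2h-odd cool n)

  -- Three green answers in a row use up the half vertex and lead back to `BB` with three edges
  -- fewer missing; any refusal gives a full end.
  BH+h-any : ∀ {ρ W} → 5 + ρ ≤ double W → Force ℓ BB (3 + ρ) (suc W) → Force ℓ BH+h (6 + ρ) (suc W)
  BH+h-any le F = BH+h-step
    (BB+h-step (BH-step F (BF+h-any (≤-trans (n≤1+n _) le))) (HF-any le))
    (BF+2h-any le)

  -- A green path with two bare ends is the hardest to close.  The probes spend up to six wasted edges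
  -- on it, which is why short cycles (k < 4) are not covered.
  Within : ℕ → ℕ → Set
  Within W m = ∀ ρ → 2 + ρ ≤ m → Force ℓ BB (2 + ρ) W

  BB-6 : Within 6 7
  BB-6 0 _ = BB-2-6
  BB-6 1 _ = BB-step (BB-6 0 (s≤s (s≤s z≤n))) (via [] (more BH-3-4))
  BB-6 2 _ = BB-step (BB-6 1 (s≤s (s≤s (s≤s z≤n)))) (via [] BH-4-5)
  BB-6 3 _ = BB-step (BB-6 2 (s≤s (s≤s (s≤s (s≤s z≤n))))) (via [] BH-5-5)
  BB-6 4 _ = BB-step (BB-6 3 (m≤m+n 5 2)) (BH+h-step (BB+h-step BH-4-5 (HF-any (m≤m+n 5 3))) (BF+2h-any (m≤m+n 5 3)))
  BB-6 5 _ = BB-step (BB-6 4 (m≤m+n 6 1)) (BH+h-step (BB+h-step BH-5-5 (HF-any (m≤m+n 6 2))) (BF+2h-any (m≤m+n 6 2)))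
  BB-6 (suc (suc (suc (suc (suc (suc ρ)))))) (s≤s (s≤s (s≤s (s≤s (s≤s (s≤s (s≤s ())))))))

  -- The extra wasted edge pays for the refusal in `BB-step`. The range grows by at most three, the
  -- number of green answers in `BH+h-any`, and is limited by the budget inequality there.
  BB-more : ∀ {W m m′} → 5 ≤ m → m′ ≤ 3 + m → m′ ≤ suc (double W) → Within (suc W) m → Within (2 + W) m′
  BB-more 5≤m _ _ F 0 _ = more (F 0 (≤-trans (m≤m+n 2 3) 5≤m))
  BB-more 5≤m _ _ F 1 _ = more (F 1 (≤-trans (m≤m+n 3 2) 5≤m))
  BB-more 5≤m _ _ F 2 _ = more (F 2 (≤-trans (m≤m+n 4 1) 5≤m))
  BB-more 5≤m _ _ F 3 _ = more (F 3 5≤m)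
  BB-more 5≤m le₁ le₂ F (suc ρ@(suc (suc (suc ρ′)))) le = BB-step
    (BB-more 5≤m le₁ le₂ F ρ (≤-trans (n≤1+n _) le))
    (BH+h-any (s≤s⁻¹ (≤-trans le le₂)) (F (suc ρ′) (+-cancelˡ-≤ 3 _ _ (≤-trans le le₁))))

  -- At `n = 0` growth by three gives 10, one short of the limit `suc (double W)` in `BB-more`. One
  -- wasted edge later the limit is attained, as `BB-within⁺` states.
  BB-within : ∀ n → Within (7 + n) (10 + double n)
  BB-within⁺ : ∀ n → Within (8 + n) (13 + double n)
  BB-within zero = BB-more (m≤m+n 5 2) ≤-refl (m≤m+n 10 1) BB-6
  BB-within (suc n) ρ le = BB-within⁺ n ρ (m≤n⇒m≤1+n le)
  BB-within⁺ n = BB-more (m≤m+n 5 _) ≤-refl ≤-refl (BB-within n)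

  -- Every branch uses its budget exactly: `BB-within⁺ n` after a green answer, `BF+2h-odd` at
  -- `4 + n` after two refusals, `BH+h-any` with equality after a refusal and a green answer.
  opening : ∀ n → Force ℓ ∅ (14 + double n) (8 + n)
  opening n = new x (new y (query x y first (swapped first) (via [] (BB-within⁺ n (11 + double n) ≤-refl))))
    where
    first : Force ℓ (mark warm x y (sprout y (sprout x ∅))) (14 + double n) (7 + n)
    first = new v (query y v tt
      (new z (forced z y (via ((x , z) ∷ (f , y) ∷ (d , x) ∷ (e , v) ∷ []) (BF+2h-odd cool (4 + n)))))
      (via ((x , v) ∷ (e , x) ∷ []) (BH+h-any ≤-refl (BB-within n (8 + double n) ≤-refl))))

empty : ∀ ℓ → Realizes ℓ false (λ _ → 0) [] ∅ ℓ
empty ℓ = record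
  { vertices = [] ; segments = [] ; unique = [] ; size = sym (+-identityʳ ℓ)
  ; distinct = λ () ; touched = λ _ () ; unlinked = λ _ () }

double≡ : ∀ n → double n ≡ n + n
double≡ zero = refl
double≡ (suc n) = cong suc (trans (cong suc (double≡ n)) (sym (+-suc n n)))

theorem4p17 : (k : ℕ) → 4 ≤ k → OnlineRamseyLE (4 * k ∸ 2) (6 * k ∸ 2)
theorem4p17 (suc (suc (suc (suc j)))) (s≤s (s≤s (s≤s (s≤s z≤n)))) =
  -- With k = 4 + j and n = 2j, the cycle needs 14 + 2n = 4k - 2 edges and 8 + n = 2k may be wasted.
  subst₂ OnlineRamseyLE (sym target) (sym rounds) (win (opening (j + j)) (empty _))
  where
  target : 4 * (4 + j) ∸ 2 ≡ 14 + double (j + j)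
  target = cong (_∸ 2) {y = 16 + double (j + j)} (trans (arith j) (cong (16 +_) (sym (double≡ (j + j)))))
    where
    arith : ∀ j → 4 * (4 + j) ≡ 16 + (j + j + (j + j))
    arith = solve-∀
  rounds : 6 * (4 + j) ∸ 2 ≡ 14 + double (j + j) + (8 + (j + j))
  rounds = cong (_∸ 2) {y = 16 + double (j + j) + (8 + (j + j))} (trans (arith j) (cong (λ n → 16 + n + (8 + (j + j))) (sym (double≡ (j + j)))))
    where
    arith : ∀ j → 6 * (4 + j) ≡ 16 + (j + j + (j + j)) + (8 + (j + j))
    arith = solve-∀
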